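{- Let $\mathcal T$ be a recursion safe $\textit{DL-Lite}^{\mathcal{HR}}$ TBox. For any two conjunctive queries $q_1,q_2$ such that $q_1\leadsto^s_{\mathcal T}q_2$, we have $cert(q_2,\mathcal T,\mathcal A)\subseteq cert(q_1,\mathcal T,\mathcal A)$ for any $k$-bounded ABox $\mathcal A$.
   Context: **Syntax and semantics.** Let $N_C,N_R,N_I$ be countably infinite sets of concept, role and individual names. A role is a role name $p$ or its inverse $p^-$; $N_R^{\pm}$ is the set of roles. TBoxes are in normal form: a $\textit{DL-Lite}_{\mathcal R}$ TBox is a finite set of axioms of the forms $A\sqsubseteq A'$, $A\sqsubseteq\exists p$, $\exists p\sqsubseteq A$, $p\sqsubseteq s$, $p\sqsubseteq s^-$, $\mathbf{disj}(A,A')$, $\mathbf{disj}(p,p')$ with $A,A'\in N_C$, $p,p',s\in N_R$. An ABox is a finite set of assertions $A(a)$, $p(a,b)$ with $a,b\in N_I$ ($p^-(a,b)\in\mathcal A$ means $p(b,a)\in\mathcal A$); $ind(\mathcal A)$ is the set of individuals in $\mathcal A$. A knowledge base (KB) is a pair $(\mathcal T,\mathcal A)$. Interpretations $\mathcal I=(\Delta^{\mathcal I},\cdot^{\mathcal I})$ have $A^{\mathcal I}\subseteq\Delta^{\mathcal I}$, $p^{\mathcal I}\subseteq\Delta^{\mathcal I}\times\Delta^{\mathcal I}$, $(p^-)^{\mathcal I}$ the converse of $p^{\mathcal I}$, $(\exists r)^{\mathcal I}=\{d\mid\exists d'.(d,d')\in r^{\mathcal I}\}$, and $a^{\mathcal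 I}=a$ for individuals (standard names). $\mathcal I$ satisfies $\alpha\sqsubseteq\beta$ iff $\alpha^{\mathcal I}\subseteq\beta^{\mathcal I}$, and $\mathbf{disj}(\alpha,\beta)$ iff $\alpha^{\mathcal I}\cap\beta^{\mathcal I}=\emptyset$; assertions as usual. A model of a KB satisfies all its axioms and assertions. **$\textit{DL-Lite}^{\mathcal{HR}}$.** Fix a set $N_{R_s}\subseteq N_R^{\pm}$ of simple roles closed under inverses; for each $r\in N_R\setminus N_{R_s}$, $r$ and $r^-$ are non-simple. A complex role inclusion (CRI) is $r\cdot s\sqsubseteq t$ with $r,s,t\in N_R$; $\mathcal I$ satisfies it if $(d_1,d_2)\in r^{\mathcal I}$ and $(d_2,d_3)\in s^{\mathcal I}$ imply $(d_1,d_3)\in t^{\mathcal I}$. A $\textit{DL-Lite}^{\mathcal{HR}}$ TBox is a $\textit{DL-Lite}_{\mathcal R}$ TBox that may also contain CRIs, such that for every CRI $r\cdot s\sqsubseteq t$ in it $s$ is simple and $t$ is non-simple, and whenever $s\sqsubseteq t\in\mathcal T$ with $t\in N_{R_s}$ then $s\in N_{R_s}$. **Recursion safety.** The recursion graph of $\mathcal T$ has a node $v_A$ (resp. $v_r$) for each concept name $A$ (resp. role name $r$) in $\mathcal T$, and edges: $v_{A_2}\to v_{A_1}$ for $A_1\sqsubseteq A_2\in\mathcal T$; $v_r\to v_t$ for $t\sqsubseteq r\in\mathcal T$; $v_p\to v_r$ for $r\sqsubseteq p^-\in\mathcal T$; $v_r\to v_A$ for $A\sqsubseteq\exists r\in\mathcal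 T$; $v_A\to v_r$ for $\exists r\sqsubseteq A\in\mathcal T$; $v_t\to v_r$ and $v_t\to v_s$ for $r\cdot s\sqsubseteq t\in\mathcal T$. A role name is recursive in $\mathcal T$ if its node participates in a cycle. Let $\sqsubseteq^{\mathsf s}_{\mathcal T}$ be the reflexive and transitive closure of $\{(s_1,s_2)\mid s_1\sqsubseteq s_2\in\mathcal T,\ s_2\in N_{R_s}\}$. $\mathcal T$ is recursion safe if every CRI $r_1\cdot s\sqsubseteq r_2\in\mathcal T$ satisfies: (i) if $v_{r_2}$ participates in some cycle of the recursion graph, then the cycle has length at most one and $r_1=r_2$; (ii) there is no axiom $A\sqsubseteq\exists t\in\mathcal T$ with $t\sqsubseteq^{\mathsf s}_{\mathcal T}s$ or $t\sqsubseteq^{\mathsf s}_{\mathcal T}s^-$. **$k$-bounded ABoxes.** For a set $S$ of simple roles and $a,b\in ind(\mathcal A)$, an $S$-path of length $n$ between $a$ and $b$ (in $\mathcal A$ w.r.t. $\mathcal T$) exists if there are pairwise distinct $d_1,\dots,d_{n-1}\in ind(\mathcal A)\setminus\{a,b\}$ and $s_1(a,d_1),\dots,s_i(d_{i-1},d_i),\dots,s_n(d_{n-1},b)\in\mathcal A$ such that for each $1\le i\le n$, $s_i\sqsubseteq^{\mathsf s}_{\mathcal T}s$ for some $s\in S$. Let $S_r=\{s\mid r\cdot s\sqsubseteq r\in\mathcal T\}$. $\mathcal A$ is $k$-bounded for $\mathcal T$ if for each recursive $r$ in $\mathcal T$ there is no $S_r$-path of length larger than $k$. **Queries.** A CQ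 is $q(\vec x)=\exists\vec y.\varphi(\vec x,\vec y)$ with $\varphi$ a conjunction of atoms $A(x)$, $r(x,y)$ ($A\in N_C$, $r\in N_R$) and $t=t'$ ($t,t'$ variables or individuals); it is identified with its set of atoms; $\vec x$ are the answer variables, $vars(q)$ all variables. $cert(q,\mathcal T,\mathcal A)$ is the set of tuples $\vec a$ over $ind(\mathcal A)$ with $\mathcal I\models q(\vec a)$ for all models $\mathcal I$ of $(\mathcal T,\mathcal A)$. **Query restraining.** For a CQ $q$, $z^q$ is a fixed variable not occurring in $q$. Write $q\leadsto^s_{\mathcal T}q'$ if $q'$ results from $q$ by one of the following (replacing the indicated atom(s)): (S1) $A_1\sqsubseteq A_2\in\mathcal T$: replace $A_2(x)$ by $A_1(x)$; (S2) $A\sqsubseteq\exists r\in\mathcal T$ and $y$ a non-answer variable occurring only once in $q$: replace $r(x,y)$ by $A(x)$; (S3) $\exists r\sqsubseteq A\in\mathcal T$: replace $A(x)$ by $r(x,z^q)$; (S4) $r\sqsubseteq s\in\mathcal T$: replace $s(x,y)$ by $r(x,y)$; (S5) $r\sqsubseteq s^-\in\mathcal T$: replace $s(x,y)$ by $r(y,x)$; (S6) $t\cdot s\sqsubseteq r\in\mathcal T$: replace $r(x,y)$ by $t(x,z^q),s(z^q,y)$; (S7) for $x,y\in vars(q)$, apply the variable substitution $[x\mapsto y]$ to $q$ (including to its answer variables). -}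

module Defs where

open import Level using (0ℓ)
open import Data.Nat using (ℕ; suc; _≤_; _≟_)
open import Data.List using (List; []; _∷_; [_]; _++_; map; concatMap; length)
open import Data.List.Membership.Propositional using (_∈_; _∉_)
open import Data.List.Relation.Unary.All using (All)
open import Data.List.Relation.Unary.Linked using (Linked)
open import Data.List.Relation.Unary.Unique.Propositional using (Unique)
open import Data.Vec as Vec using (Vec)
open import Data.Vec.Relation.Unary.All as VecAll using ()
open import Data.Product using (Σ; ∃!; ∃-syntax; _×_; _,_; proj₁)
open import Data.Sum using (_⊎_)
open import Function.Definitions using (Injective)
open import Relation.Binary.Core using (Rel)
open import Relation.Binary.Construct.Closure.ReflexiveTransitive using (Star)
open import Relation.Binary.PropositionalEquality using (_≡_; _≢_)
open import Relation.Nullary using (¬_; yes; no)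
open import Relation.Unary using (Pred; _⊆_; _⊥_; _≐_; _∩_; _∪_)

ConceptName RoleName Ind Var : Set
ConceptName = ℕ
RoleName    = ℕ
Ind         = ℕ
Var         = ℕ

data Role : Set where
  name : RoleName → Role
  inv  : RoleName → Role

_⁻ : Role → Role
name p ⁻ = inv p
inv p  ⁻ = name p

baseName : Role → RoleName
baseName (name p) = p
baseName (inv p)  = p

-- A ⊑∃ p stands for A ⊑ ∃p, p ∃⊑ A for ∃p ⊑ A, and p ⊑ʳ ρ covers both
-- p ⊑ s and p ⊑ s⁻.  The last constructor is the complex role inclusion.
infix 4 _⊑ᶜ_ _⊑∃_ _∃⊑_ _⊑ʳ_ _·_⊑_

data Axiom : Set where
  _⊑ᶜ_  : ConceptName → ConceptName → Axiom
  _⊑∃_  : ConceptName → RoleName → Axiom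
  _∃⊑_  : RoleName → ConceptName → Axiom
  _⊑ʳ_  : RoleName → Role → Axiom
  disjᶜ : ConceptName → ConceptName → Axiom
  disjʳ : RoleName → RoleName → Axiom
  _·_⊑_ : RoleName → RoleName → RoleName → Axiom

TBox : Set
TBox = List Axiom

data Assertion : Set where
  concept : ConceptName → Ind → Assertion
  role    : RoleName → Ind → Ind → Assertion

ABox : Set
ABox = List Assertion

roleAssertion : Role → Ind → Ind → Assertion
roleAssertion (name p) a b = role p a b
roleAssertion (inv p)  a b = role p b a

assertionInds : Assertion → List Ind
assertionInds (concept A a) = [ a ]
assertionInds (role p a b)  = a ∷ b ∷ []

ind : ABox → List Ind
ind = concatMap assertionInds

-- Standard names: the individuals form a subset of the domain, given by an
-- injection that interprets each individual as itself.
record Interpretation : Set₁ where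
  field
    Δ             : Set
    ⟦_⟧           : Ind → Δ
    ⟦⟧-injective  : Injective _≡_ _≡_ ⟦_⟧
    conceptExt    : ConceptName → Pred Δ 0ℓ
    roleNameExt   : RoleName → Pred (Δ × Δ) 0ℓ

  roleExt : Role → Pred (Δ × Δ) 0ℓ
  roleExt (name p) (d , e) = roleNameExt p (d , e)
  roleExt (inv p)  (d , e) = roleNameExt p (e , d)

  existsExt : Role → Pred Δ 0ℓ
  existsExt ρ d = ∃[ e ] roleExt ρ (d , e)

  SatisfiesAxiom : Axiom → Set
  SatisfiesAxiom (A ⊑ᶜ A′)    = conceptExt A ⊆ conceptExt A′
  SatisfiesAxiom (A ⊑∃ p)     = conceptExt A ⊆ existsExt (name p)
  SatisfiesAxiom (p ∃⊑ A)     = existsExt (name p) ⊆ conceptExt A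
  SatisfiesAxiom (p ⊑ʳ ρ)     = roleExt (name p) ⊆ roleExt ρ
  SatisfiesAxiom (disjᶜ A A′) = conceptExt A ⊥ conceptExt A′
  SatisfiesAxiom (disjʳ p p′) = roleExt (name p) ⊥ roleExt (name p′)
  SatisfiesAxiom (r · s ⊑ t)  = ∀ {d₁ d₂ d₃} →
    roleExt (name r) (d₁ , d₂) → roleExt (name s) (d₂ , d₃) →
    roleExt (name t) (d₁ , d₃)

  SatisfiesAssertion : Assertion → Set
  SatisfiesAssertion (concept A a) = conceptExt A ⟦ a ⟧
  SatisfiesAssertion (role p a b)  = roleExt (name p) (⟦ a ⟧ , ⟦ b ⟧)

record IsModel (I : Interpretation) (T : TBox) (𝒜 : ABox) : Set where
  open Interpretation I
  field
    tbox : All SatisfiesAxiom T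
    abox : All SatisfiesAssertion 𝒜

record SimpleRoles : Set₁ where
  field
    Simple         : Pred Role 0ℓ
    inverse-closed : ∀ {ρ} → Simple ρ → Simple (ρ ⁻)

open SimpleRoles public using (Simple)

record IsDLLiteHR (N : SimpleRoles) (T : TBox) : Set where
  field
    cri-simple    : ∀ {r s t} → (r · s ⊑ t) ∈ T → Simple N (name s)
    cri-nonsimple : ∀ {r s t} → (r · s ⊑ t) ∈ T → ¬ Simple N (name t)
    ri-simple     : ∀ {s ρ} → (s ⊑ʳ ρ) ∈ T → Simple N ρ → Simple N (name s)

data Node : Set where
  conceptNode : ConceptName → Node
  roleNode    : RoleName → Node

-- Names that do not occur in T give isolated nodes, hence nodes on no cycle.
data Edge (T : TBox) : Rel Node 0ℓ where
  ⊑ᶜ-edge : ∀ {A₁ A₂} → (A₁ ⊑ᶜ A₂) ∈ T → Edge T (conceptNode A₂) (conceptNode A₁)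
  ⊑ʳ-edge : ∀ {r ρ} → (r ⊑ʳ ρ) ∈ T → Edge T (roleNode (baseName ρ)) (roleNode r)
  ⊑∃-edge : ∀ {A r} → (A ⊑∃ r) ∈ T → Edge T (roleNode r) (conceptNode A)
  ∃⊑-edge : ∀ {r A} → (r ∃⊑ A) ∈ T → Edge T (conceptNode A) (roleNode r)
  ·-edge₁ : ∀ {r s t} → (r · s ⊑ t) ∈ T → Edge T (roleNode t) (roleNode r)
  ·-edge₂ : ∀ {r s t} → (r · s ⊑ t) ∈ T → Edge T (roleNode t) (roleNode s)

-- Cycles do not repeat nodes: otherwise running twice through a self-loop
-- would be a cycle of length two.
record Cycle (T : TBox) : Set where
  field
    start    : Node
    rest     : List Node
    distinct : Unique (start ∷ rest)
    edges    : Linked (Edge T) (start ∷ rest ++ [ start ])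

  nodes : List Node
  nodes = start ∷ rest

open Cycle public using (nodes)

cycleLength : ∀ {T} → Cycle T → ℕ
cycleLength c = length (nodes c)

Recursive : TBox → Pred RoleName 0ℓ
Recursive T r = Σ (Cycle T) λ c → roleNode r ∈ nodes c

data SimpleStep (N : SimpleRoles) (T : TBox) : Rel Role 0ℓ where
  step : ∀ {s ρ} → (s ⊑ʳ ρ) ∈ T → Simple N ρ → SimpleStep N T (name s) ρ

SimpleIncl : SimpleRoles → TBox → Rel Role 0ℓ
SimpleIncl N T = Star (SimpleStep N T)

record RecursionSafe (N : SimpleRoles) (T : TBox) : Set where
  field
    cycles   : ∀ {r₁ s r₂} → (r₁ · s ⊑ r₂) ∈ T →
               ∀ (c : Cycle T) → roleNode r₂ ∈ nodes c →
               cycleLength c ≤ 1 × r₁ ≡ r₂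
    no-exist : ∀ {r₁ s r₂} → (r₁ · s ⊑ r₂) ∈ T →
               ∀ {A t} → (A ⊑∃ t) ∈ T →
               ¬ (SimpleIncl N T (name t) (name s) ⊎ SimpleIncl N T (name t) (inv s))

PathStep : SimpleRoles → TBox → ABox → Pred Role 0ℓ → Rel Ind 0ℓ
PathStep N T 𝒜 S a b =
  ∃[ ρ ] roleAssertion ρ a b ∈ 𝒜 × ∃[ σ ] S σ × SimpleIncl N T ρ σ

record Path (N : SimpleRoles) (T : TBox) (𝒜 : ABox) (S : Pred Role 0ℓ)
            (a b : Ind) (n : ℕ) : Set where
  field
    inner      : List Ind
    is-length  : n ≡ suc (length inner)
    distinct   : Unique inner
    inner-inds : All (λ d → d ∈ ind 𝒜 × d ≢ a × d ≢ b) inner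
    steps      : Linked (PathStep N T 𝒜 S) (a ∷ inner ++ [ b ])

RecursionRoles : TBox → RoleName → Pred Role 0ℓ
RecursionRoles T r σ = ∃[ s ] σ ≡ name s × (r · s ⊑ r) ∈ T

Bounded : SimpleRoles → TBox → ℕ → Pred ABox 0ℓ
Bounded N T k 𝒜 =
  ∀ {r} → Recursive T r →
  ∀ {a b} → a ∈ ind 𝒜 → b ∈ ind 𝒜 →
  ∀ {n} → Path N T 𝒜 (RecursionRoles T r) a b n → n ≤ k

data Term : Set where
  var  : Var → Term
  indv : Ind → Term

data Atom : Set where
  conceptAtom : ConceptName → Var → Atom
  roleAtom    : RoleName → Var → Var → Atom
  _≈ᵃ_        : Term → Term → Atom

termVars : Term → List Var
termVars (var x)  = [ x ]
termVars (indv a) = []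

atomVars : Atom → List Var
atomVars (conceptAtom A x) = [ x ]
atomVars (roleAtom r x y)  = x ∷ y ∷ []
atomVars (t ≈ᵃ t′)         = termVars t ++ termVars t′

-- The list of atoms represents the set of its members; every definition
-- below depends on it only through membership.
record CQ (n : ℕ) : Set where
  constructor cq
  field
    answers : Vec Var n
    atoms   : List Atom

open CQ public

vars : ∀ {n} → CQ n → List Var
vars q = Vec.toList (answers q) ++ concatMap atomVars (atoms q)

module _ (I : Interpretation) where
  open Interpretation I

  termValue : (Var → Δ) → Term → Δ
  termValue π (var x)  = π x
  termValue π (indv a) = ⟦ a ⟧

  SatisfiesAtom : (Var → Δ) → Pred Atom 0ℓ
  SatisfiesAtom π (conceptAtom A x) = conceptExt A (π x)
  SatisfiesAtom π (roleAtom r x y)  = roleExt (name r) (π x , π y)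
  SatisfiesAtom π (t ≈ᵃ t′)         = termValue π t ≡ termValue π t′

  SatisfiesQuery : ∀ {n} → CQ n → Pred (Vec Ind n) 0ℓ
  SatisfiesQuery q a⃗ = Σ (Var → Δ) λ π →
    Vec.map π (answers q) ≡ Vec.map ⟦_⟧ a⃗ × All (SatisfiesAtom π) (atoms q)

cert : ∀ {n} → CQ n → TBox → ABox → Vec Ind n → Set₁
cert q T 𝒜 a⃗ =
  VecAll.All (_∈ ind 𝒜) a⃗ × (∀ I → IsModel I T 𝒜 → SatisfiesQuery I q a⃗)

record FreshVariable : Set where
  field
    zvar  : ∀ {n} → CQ n → Var
    fresh : ∀ {n} (q : CQ n) → zvar q ∉ vars q

open FreshVariable public using (zvar)

-- q′ arises from q by replacing the atom α by the atoms βs.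
record Replaces {n} (q : CQ n) (α : Atom) (βs : List Atom) (q′ : CQ n) : Set where
  field
    present      : α ∈ atoms q
    same-answers : answers q′ ≡ answers q
    new-atoms    : (_∈ atoms q′) ≐ (((_∈ atoms q) ∩ (_≢ α)) ∪ (_∈ βs))

-- An occurrence is an atom together with a position of the variable in it: a
-- proof of list membership is a position.
OccursOnce : ∀ {n} → CQ n → Var → Set
OccursOnce q y =
  ∃! _≡_ λ (o : Σ Atom λ α → y ∈ atomVars α) → proj₁ o ∈ atoms q

substVar : Var → Var → Var → Var
substVar x y v with v ≟ x
... | yes _ = y
... | no  _ = v

substTerm : Var → Var → Term → Term
substTerm x y (var v)  = var (substVar x y v)
substTerm x y (indv a) = indv a

substAtom : Var → Var → Atom → Atom
substAtom x y (conceptAtom A v) = conceptAtom A (substVar x y v)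
substAtom x y (roleAtom r v w)  = roleAtom r (substVar x y v) (substVar x y w)
substAtom x y (t ≈ᵃ t′)         = substTerm x y t ≈ᵃ substTerm x y t′

data Restrains (Z : FreshVariable) (T : TBox) {n} (q q′ : CQ n) : Set where
  S1 : ∀ {A₁ A₂ x} → (A₁ ⊑ᶜ A₂) ∈ T →
       Replaces q (conceptAtom A₂ x) [ conceptAtom A₁ x ] q′ → Restrains Z T q q′
  S2 : ∀ {A r x y} → (A ⊑∃ r) ∈ T →
       y ∉ Vec.toList (answers q) → OccursOnce q y →
       Replaces q (roleAtom r x y) [ conceptAtom A x ] q′ → Restrains Z T q q′
  S3 : ∀ {r A x} → (r ∃⊑ A) ∈ T →
       Replaces q (conceptAtom A x) [ roleAtom r x (zvar Z q) ] q′ → Restrains Z T q q′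
  S4 : ∀ {r s x y} → (r ⊑ʳ name s) ∈ T →
       Replaces q (roleAtom s x y) [ roleAtom r x y ] q′ → Restrains Z T q q′
  S5 : ∀ {r s x y} → (r ⊑ʳ inv s) ∈ T →
       Replaces q (roleAtom s x y) [ roleAtom r y x ] q′ → Restrains Z T q q′
  S6 : ∀ {t s r x y} → (t · s ⊑ r) ∈ T →
       Replaces q (roleAtom r x y)
         (roleAtom t x (zvar Z q) ∷ roleAtom s (zvar Z q) y ∷ []) q′ → Restrains Z T q q′
  S7 : ∀ {x y} → x ∈ vars q → y ∈ vars q →
       answers q′ ≡ Vec.map (substVar x y) (answers q) →
       (_∈ atoms q′) ≐ (_∈ map (substAtom x y) (atoms q)) → Restrains Z T q q′

{-# OPTIONS --safe #-}
module Submission where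

open import Defs
open import Data.Fin using (toℕ)
open import Data.List using ([]; _∷_)
open import Data.List.Membership.Propositional using (_∈_; _∉_)
open import Data.List.Membership.Propositional.Properties using (∈-map⁺; ∈-++⁺ˡ; ∈-++⁺ʳ)
open import Data.List.Relation.Unary.All as All using (All; []; _∷_)
open import Data.List.Relation.Unary.Any using (here; there; index)
open import Data.Nat using (ℕ; _≟_)
open import Data.Product using (∃-syntax; _,_; proj₁; proj₂)
open import Data.Sum using (inj₁; inj₂)
open import Data.Vec as Vec using (Vec; []; _∷_)
open import Data.Vec.Properties using (map-∘)
open import Function using (_∘_)
open import Relation.Binary.Definitions using (DecidableEquality)
open import Relation.Binary.PropositionalEquality
open import Relation.Nullary using (yes; no; contradiction)
open import Relation.Nullary.Decidable using (map′; _×-dec_)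
open import Relation.Unary using (_⊆_)

-- Every model of the KB is a model in which a match of q₂ yields a match of q₁:
-- the same assignment works, except that S2 redirects y to the r-successor
-- provided by A ⊑ ∃r, which is harmless since y occurs nowhere else, and that S7
-- precomposes the assignment with the substitution.

infix 4 _≟ᵗ_ _≟ᵃ_

_≟ᵗ_ : DecidableEquality Term
var x  ≟ᵗ var y  = map′ (cong var) (λ { refl → refl }) (x ≟ y)
var x  ≟ᵗ indv b = no λ ()
indv a ≟ᵗ var y  = no λ ()
indv a ≟ᵗ indv b = map′ (cong indv) (λ { refl → refl }) (a ≟ b)

-- `Replaces` keeps exactly the atoms different from the replaced one, so transferring a match back
-- requires deciding, for each atom of the original query, which of the two cases it is in.
_≟ᵃ_ : DecidableEquality Atom
conceptAtom A x ≟ᵃ conceptAtom B y =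
  map′ (λ { (refl , refl) → refl }) (λ { refl → refl , refl }) (A ≟ B ×-dec x ≟ y)
conceptAtom A x ≟ᵃ roleAtom s v w  = no λ ()
conceptAtom A x ≟ᵃ (u ≈ᵃ u′)       = no λ ()
roleAtom r x y  ≟ᵃ conceptAtom B v = no λ ()
roleAtom r x y  ≟ᵃ roleAtom s v w  =
  map′ (λ { (refl , refl , refl) → refl }) (λ { refl → refl , refl , refl })
    (r ≟ s ×-dec x ≟ v ×-dec y ≟ w)
roleAtom r x y  ≟ᵃ (u ≈ᵃ u′)       = no λ ()
(t ≈ᵃ t′)       ≟ᵃ conceptAtom B v = no λ ()
(t ≈ᵃ t′)       ≟ᵃ roleAtom s v w  = no λ ()
(t ≈ᵃ t′)       ≟ᵃ (u ≈ᵃ u′)       =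
  map′ (λ { (refl , refl) → refl }) (λ { refl → refl , refl }) (t ≟ᵗ u ×-dec t′ ≟ᵗ u′)

update : {D : Set} → (Var → D) → Var → D → Var → D
update π y d v with v ≟ y
... | yes _ = d
... | no  _ = π v

update-≡ : ∀ {D : Set} (π : Var → D) y d → update π y d y ≡ d
update-≡ π y d with y ≟ y
... | yes _  = refl
... | no y≢y = contradiction refl y≢y

update-≢ : ∀ {D : Set} (π : Var → D) {y} d {v} → v ≢ y → update π y d v ≡ π v
update-≢ π {y} d {v} v≢y with v ≟ y
... | yes v≡y = contradiction v≡y v≢y
... | no  _   = refl

-- Stated for a list of variables so that it serves both the answer variables and the variables of a
-- single atom.
update-∉ : ∀ {D : Set} (π : Var → D) {y} d {vs} → y ∉ vs →
           ∀ {v} → v ∈ vs → update π y d v ≡ π v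
update-∉ π d y∉vs v∈vs = update-≢ π d λ { refl → y∉vs v∈vs }

map-cong-∈ : ∀ {A B : Set} {f g : A → B} {n} (xs : Vec A n) →
             (∀ {x} → x ∈ Vec.toList xs → f x ≡ g x) → Vec.map f xs ≡ Vec.map g xs
map-cong-∈ []       f≗g = refl
map-cong-∈ (x ∷ xs) f≗g = cong₂ _∷_ (f≗g (here refl)) (map-cong-∈ xs (f≗g ∘ there))

module _ {n} (q : CQ n) {y : Var} (once : OccursOnce q y) where

  occurrence-unique : ∀ {α β} → α ∈ atoms q → β ∈ atoms q →
    (p : y ∈ atomVars α) (p′ : y ∈ atomVars β) →
    _≡_ {A = ∃[ γ ] y ∈ atomVars γ} (α , p) (β , p′)
  occurrence-unique α∈q β∈q p p′ =
    trans (sym (unique α∈q)) (unique β∈q)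
    where unique = proj₂ (proj₂ once)

  occurs-in-one-atom : ∀ {α β} → α ∈ atoms q → β ∈ atoms q →
    y ∈ atomVars α → y ∈ atomVars β → α ≡ β
  occurs-in-one-atom α∈q β∈q p p′ = cong proj₁ (occurrence-unique α∈q β∈q p p′)

  -- In an atom `roleAtom r y y` the variable has two positions, and `OccursOnce` counts positions,
  -- not just atoms.
  no-role-loop : ∀ {r x} → roleAtom r x y ∈ atoms q → x ≢ y
  no-role-loop α∈q refl
    -- Reading off the position turns the equality of occurrences into 0 ≡ 1. The type of `index`
    -- depends on the atom, so `toℕ` brings all positions into one type.
    with () ← cong (λ o → toℕ (index (proj₂ o)))
                (occurrence-unique α∈q α∈q (here refl) (there (here refl)))

module _ (I : Interpretation) where
  open Interpretation I

  termValue-cong : ∀ {π ρ} t → (∀ {v} → v ∈ termVars t → π v ≡ ρ v) →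
    termValue I π t ≡ termValue I ρ t
  termValue-cong (var x)  π≗ρ = π≗ρ (here refl)
  termValue-cong (indv a) π≗ρ = refl

  SatisfiesAtom-cong : ∀ {π ρ} α → (∀ {v} → v ∈ atomVars α → π v ≡ ρ v) →
    SatisfiesAtom I π α → SatisfiesAtom I ρ α
  SatisfiesAtom-cong (conceptAtom A x) π≗ρ = subst (conceptExt A) (π≗ρ (here refl))
  SatisfiesAtom-cong (roleAtom r x y)  π≗ρ =
    subst (roleExt (name r)) (cong₂ _,_ (π≗ρ (here refl)) (π≗ρ (there (here refl))))
  SatisfiesAtom-cong (t ≈ᵃ t′)         π≗ρ eq =
    trans (sym (termValue-cong t (π≗ρ ∘ ∈-++⁺ˡ)))
      (trans eq (termValue-cong t′ (π≗ρ ∘ ∈-++⁺ʳ (termVars t))))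

  termValue-subst : ∀ π x y t →
    termValue I π (substTerm x y t) ≡ termValue I (π ∘ substVar x y) t
  termValue-subst π x y (var v)  = refl
  termValue-subst π x y (indv a) = refl

  SatisfiesAtom-subst : ∀ π x y α →
    SatisfiesAtom I π (substAtom x y α) → SatisfiesAtom I (π ∘ substVar x y) α
  SatisfiesAtom-subst π x y (conceptAtom A v) sat = sat
  SatisfiesAtom-subst π x y (roleAtom r v w)  sat = sat
  -- Unlike variables, terms do not reduce under `substTerm` until they are split.
  SatisfiesAtom-subst π x y (t ≈ᵃ t′)         eq  =
    trans (sym (termValue-subst π x y t)) (trans eq (termValue-subst π x y t′))

  -- Two assignments are kept apart, `π` matching the new query and `ρ` the old one, because S2
  -- changes the assignment; the other replacement rules take them equal.
  SatisfiesQuery-replace-under : ∀ {n} {q q′ : CQ n} {α βs π ρ} → Replaces q α βs q′ →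
    (∀ {v} → v ∈ Vec.toList (answers q) → ρ v ≡ π v) →
    (∀ {γ} → γ ∈ atoms q → γ ≢ α → SatisfiesAtom I π γ → SatisfiesAtom I ρ γ) →
    (All (SatisfiesAtom I π) βs → SatisfiesAtom I ρ α) →
    ∀ {a⃗} → Vec.map π (answers q′) ≡ Vec.map ⟦_⟧ a⃗ → All (SatisfiesAtom I π) (atoms q′) →
    SatisfiesQuery I q a⃗
  SatisfiesQuery-replace-under {q = q} {q′} {α} {π = π} {ρ} R ρ≗π others replaced ans sat =
    ρ ,
    trans (map-cong-∈ (answers q) ρ≗π) (subst (λ xs → Vec.map π xs ≡ _) same-answers ans) ,
    All.tabulate satisfied
    where
    open Replaces R
    satisfied : ∀ {γ} → γ ∈ atoms q → SatisfiesAtom I ρ γ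
    satisfied {γ} γ∈q with γ ≟ᵃ α
    ... | yes refl = replaced (All.tabulate λ β∈βs → All.lookup sat (proj₂ new-atoms (inj₂ β∈βs)))
    ... | no γ≢α   =
      others γ∈q γ≢α (All.lookup sat (proj₂ new-atoms (inj₁ (γ∈q , γ≢α))))

  SatisfiesQuery-replace : ∀ {n} {q q′ : CQ n} {α βs} → Replaces q α βs q′ →
    (∀ {π} → All (SatisfiesAtom I π) βs → SatisfiesAtom I π α) →
    SatisfiesQuery I q′ ⊆ SatisfiesQuery I q
  SatisfiesQuery-replace R implied (π , ans , sat) =
    SatisfiesQuery-replace-under R (λ _ → refl) (λ _ _ s → s) implied ans sat

  SatisfiesQuery-replace-exists : ∀ {n} {q q′ : CQ n} {A r x y} →
    SatisfiesAxiom (A ⊑∃ r) → y ∉ Vec.toList (answers q) → OccursOnce q y →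
    Replaces q (roleAtom r x y) (conceptAtom A x ∷ []) q′ →
    SatisfiesQuery I q′ ⊆ SatisfiesQuery I q
  SatisfiesQuery-replace-exists {q = q} {r = r} {x} {y} A⊑∃r y∉ans once R (π , ans , sat)
    with sat-A ← All.lookup sat (proj₂ (Replaces.new-atoms R) (inj₂ (here refl)))
    with d , x-r-d ← A⊑∃r sat-A =
    SatisfiesQuery-replace-under R (update-∉ π d y∉ans) others (λ _ → replaced) ans sat
    where
    α∈q = Replaces.present R
    ρ = update π y d
    others : ∀ {γ} → γ ∈ atoms q → γ ≢ roleAtom r x y → SatisfiesAtom I π γ → SatisfiesAtom I ρ γ
    others {γ} γ∈q γ≢α = SatisfiesAtom-cong γ (sym ∘ update-∉ π d λ y∈γ →
      γ≢α (occurs-in-one-atom q once γ∈q α∈q y∈γ (there (here refl))))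
    replaced : SatisfiesAtom I ρ (roleAtom r x y)
    -- As `x` differs from `y`, the update leaves the first argument at `π x`, of which `d` is an
    -- `r`-successor.
    replaced = subst (roleExt (name r))
      (sym (cong₂ _,_ (update-≢ π d (no-role-loop q once α∈q)) (update-≡ π y d))) x-r-d

  SatisfiesQuery-restrain : ∀ {Z T n} {q q′ : CQ n} → All SatisfiesAxiom T → Restrains Z T q q′ →
    SatisfiesQuery I q′ ⊆ SatisfiesQuery I q
  SatisfiesQuery-restrain ⊨T (S1 ax R) =
    SatisfiesQuery-replace R λ { (s ∷ []) → All.lookup ⊨T ax s }
  SatisfiesQuery-restrain ⊨T (S2 ax y∉ans once R) =
    SatisfiesQuery-replace-exists (All.lookup ⊨T ax) y∉ans once R
  SatisfiesQuery-restrain ⊨T (S3 ax R) =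
    -- The value of `zvar Z q` under the match is the witness for the existential.
    SatisfiesQuery-replace R λ { (s ∷ []) → All.lookup ⊨T ax (_ , s) }
  SatisfiesQuery-restrain ⊨T (S4 ax R) =
    SatisfiesQuery-replace R λ { (s ∷ []) → All.lookup ⊨T ax s }
  SatisfiesQuery-restrain ⊨T (S5 ax R) =
    -- `roleExt` of an inverse role computes to the swapped pair, which undoes the exchange of `x`
    -- and `y`.
    SatisfiesQuery-replace R λ { (s ∷ []) → All.lookup ⊨T ax s }
  SatisfiesQuery-restrain ⊨T (S6 ax R) =
    SatisfiesQuery-replace R λ { (s₁ ∷ s₂ ∷ []) → All.lookup ⊨T ax s₁ s₂ }
  SatisfiesQuery-restrain {q = q} ⊨T (S7 {x} {y} _ _ same new) (π , ans , sat) =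
    π ∘ substVar x y ,
    trans (map-∘ π (substVar x y) (answers q)) (trans (sym (cong (Vec.map π) same)) ans) ,
    All.tabulate λ {α} α∈q → SatisfiesAtom-subst π x y α
      (All.lookup sat (proj₂ new (∈-map⁺ (substAtom x y) α∈q)))

proposition2 : ∀ (N : SimpleRoles) (Z : FreshVariable) (T : TBox) → IsDLLiteHR N T → RecursionSafe N T →
    ∀ {n : ℕ} (q₁ q₂ : CQ n) → Restrains Z T q₁ q₂ →
    ∀ (k : ℕ) (𝒜 : ABox) → Bounded N T k 𝒜 →
    cert q₂ T 𝒜 ⊆ cert q₁ T 𝒜
proposition2 N Z T _ _ q₁ q₂ q₁⇝q₂ k 𝒜 _ (a⃗∈𝒜 , q₂-holds) =
  -- The range condition on the tuple mentions only the ABox, so it carries over as it is.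
  a⃗∈𝒜 , λ I M → SatisfiesQuery-restrain I (IsModel.tbox M) q₁⇝q₂ (q₂-holds I M)
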